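{- The cubic edge-type relaxation (the system of linear constraints on type densities defined in the context) has a feasible point with uncovered-vertex density $\rho > 0$. Hence no family of linear inequalities valid at all feasible points of the relaxation (that is, no linear discharging over edge-multiplicity profiles together with the counting constraints) can force $\rho = 0$.
   Context: The cubic edge-type relaxation is the following linear system. A type is a pair $t=(C,U)$ where $C$ is a multiset of size at most $2$ with entries in $\{1,2,3\}$ (the "chosen" multiset) and $U$ is a multiset of size at most $2$ with entries in $\{0,1,2\}$ (the "unchosen" multiset). For a type $t=(C,U)$ let $p_t,q_t$ be the numbers of entries of $C$ equal to $1$ and $2$ respectively, and $a_t,b_t$ the numbers of entries of $U$ equal to $0$ and $1$ respectively. For each $j$, let $c_j(t)$ be the number of entries of $C$ equal to $j$ and $u_j(t)$ the number of entries of $U$ equal to $j$. A feasible point is a probability density $x=(x_t)$ over types (all $x_t \ge 0$, $\sum_t x_t = 1$) such that: (i) (per-edge inequality) every type $t$ with $x_t>0$ satisfies $3p_t+q_t \ge 3a_t+b_t$; (ii) (counting constraints) $\sum_t x_t u_1(t) = 2\sum_t x_t c_1(t)$ and $\sum_t x_t c_2(t) = 2\sum_t x_t u_2(t)$. The uncovered-vertex density of $x$ is $\rho = \tfrac13\sum_t x_t u_0(t)$. (Origin of the system: in a cubic graph with a maximal matching $M$ and one chosen endpoint per $M$-edge, a vertex not covered by $M$ is at risk if its three neighbours lie on distinct $M$-edges, and its multiplicity is its number of chosen neighbours. The type of an $M$-edge records the multisets of multiplicities of the at-risk neighbours of its chosen and unchosen endpoint, and $x_t$ is the fraction of $M$-edges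 of type $t$.) -}

module Defs where

open import Algebra.Apartness.Bundles using (HeytingField; HeytingCommutativeRing)
open import Algebra.Bundles using (CommutativeRing)
import Algebra.Properties.Monoid.Mult as Mult
import Algebra.Properties.Monoid.Sum as Sum
open import Data.Bool.Base using (if_then_else_)
open import Data.List.Base using (List; []; _∷_; cartesianProduct)
open import Data.List.Membership.Propositional using (_∈_)
open import Data.List.Membership.Propositional.Properties using (∈-cartesianProduct⁺)
open import Data.List.Relation.Unary.Any using (here; there)
open import Data.List.Relation.Unary.Unique.Propositional using (Unique)
open import Data.List.Relation.Unary.Unique.Propositional.Properties using (cartesianProduct⁺)
import Data.List.Relation.Unary.Unique.DecPropositional as DecUnique
import Data.Nat.Base as ℕ
open ℕ using (ℕ; zero; suc; _≡ᵇ_; s≤s)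
import Data.Nat.Properties as ℕ
open import Data.Product.Base using (_×_; _,_; proj₁; proj₂)
import Data.Rational.Base as ℚ
import Data.Rational.Properties as ℚ
open import Data.Sum.Base using (_⊎_; inj₁; inj₂; [_,_]′)
open import Data.Vec.Functional using (fromList; map)
open import Function.Bundles using (_⇔_; mk⇔; module Equivalence)
open import Level using (_⊔_; 0ℓ) renaming (suc to lsuc)
open import Relation.Binary.Core using (Rel)
open import Relation.Binary.Definitions using (DecidableEquality; tri<; tri≈; tri>)
open import Relation.Binary.PropositionalEquality.Core as ≡ using (_≡_)
open import Relation.Binary.Structures using (IsStrictPartialOrder)
open import Relation.Nullary.Decidable using (True; toWitness; map′; _×-dec_; from-yes; recompute)
open import Relation.Nullary.Negation using (¬_; contradiction)

------------------------------------------------------------------------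
-- Ordered fields

-- The library has no real numbers, so the relaxation is set up over an
-- arbitrary ordered field. The axioms do not ask for decidability of
-- _<_, so that ℚ as well as the real numbers (classical or
-- constructive) satisfy them.

record OrderedField c ℓ₁ ℓ₂ ℓ₃ : Set (lsuc (c ⊔ ℓ₁ ⊔ ℓ₂ ⊔ ℓ₃)) where
  field
    heytingField : HeytingField c ℓ₁ ℓ₂

  open HeytingField heytingField public
  open HeytingCommutativeRing heytingCommutativeRing public
    using (commutativeRing)
  open CommutativeRing commutativeRing public using (+-monoid)

  infix 4 _<_ _≤_

  field
    _<_                  : Rel Carrier ℓ₃
    isStrictPartialOrder : IsStrictPartialOrder _≈_ _<_
    #⇔<⊎>                : ∀ x y → x # y ⇔ (x < y ⊎ y < x)
    0<1                  : 0# < 1#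
    +-monoˡ-<            : ∀ z {x y} → x < y → x + z < y + z
    *-pos                : ∀ {x y} → 0# < x → 0# < y → 0# < x * y

  open IsStrictPartialOrder isStrictPartialOrder public
    using (<-respˡ-≈; <-respʳ-≈; <-resp-≈)
    renaming (irrefl to <-irrefl; trans to <-trans; asym to <-asym)

  _≤_ : Rel Carrier ℓ₃
  x ≤ y = ¬ (y < x)

  open Mult +-monoid public using () renaming (_×_ to infixr 8 _·_)
  open Sum +-monoid public using (sum)

  suc·1-pos : ∀ n → 0# < suc n · 1#
  suc·1-pos zero    = <-respʳ-≈ (sym (+-identityʳ 1#)) 0<1
  suc·1-pos (suc n) =
    <-trans (suc·1-pos n) (<-respˡ-≈ (+-identityˡ _) (+-monoˡ-< _ 0<1))

  private
    3#0 : 3 · 1# # 0#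
    3#0 = Equivalence.from (#⇔<⊎> _ _) (inj₂ (suc·1-pos 2))

  -- The library only provides inverses of differences x - y with x # y.
  ⅓ : Carrier
  ⅓ = proj₁ (#⇒invertible 3#0)

  ⅓-inverse : ⅓ * (3 · 1#) ≈ 1#
  ⅓-inverse = trans (*-congˡ (sym x-0≈x)) (proj₁ (proj₂ (#⇒invertible 3#0)))
    where
    x-0≈x : 3 · 1# - 0# ≈ 3 · 1#
    x-0≈x = trans (sym (+-identityʳ _))
      (trans (+-assoc _ _ _) (trans (+-congˡ (-‿inverseˡ 0#)) (+-identityʳ _)))

ℚ-orderedField : OrderedField 0ℓ 0ℓ 0ℓ 0ℓ
ℚ-orderedField = record
  { heytingField         = ℚ.heytingField
  ; _<_                  = ℚ._<_
  ; isStrictPartialOrder = ℚ.<-isStrictPartialOrder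
  ; #⇔<⊎>                = λ x y → mk⇔ (to x y)
      [ ℚ.<⇒≢ , (λ y<x x≡y → ℚ.<⇒≢ y<x (≡.sym x≡y)) ]′
  ; 0<1                  = ℚ.positive⁻¹ ℚ.1ℚ
  ; +-monoˡ-<            = λ z → ℚ.+-monoˡ-< z
  ; *-pos                = λ {x} {y} 0<x 0<y → ℚ.positive⁻¹ (x ℚ.* y)
      {{ℚ.pos*pos⇒pos x {{ℚ.positive 0<x}} y {{ℚ.positive 0<y}}}}
  }
  where
  to : ∀ x y → ¬ x ≡ y → x ℚ.< y ⊎ y ℚ.< x
  to x y x≢y with ℚ.<-cmp x y
  ... | tri< x<y _ _ = inj₁ x<y
  ... | tri≈ _ x≡y _ = contradiction x≡y x≢y
  ... | tri> _ _ y<x = inj₂ y<x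

------------------------------------------------------------------------
-- Edge types

-- A multiset of size at most 2 with entries in {lo, lo + 1, lo + 2},
-- given by the multiplicities n₀, n₁, n₂ of these three entries. The
-- size bound is irrelevant, so propositional equality is equality of
-- multisets.

record Multiset≤2 (lo : ℕ) : Set where
  constructor multiset
  field
    n₀ n₁ n₂ : ℕ
    .size≤2  : n₀ ℕ.+ n₁ ℕ.+ n₂ ℕ.≤ 2

  count : ℕ → ℕ
  count j = (if j ≡ᵇ lo         then n₀ else 0)
      ℕ.+ (if j ≡ᵇ suc lo       then n₁ else 0)
      ℕ.+ (if j ≡ᵇ suc (suc lo) then n₂ else 0)

open Multiset≤2 public using (count)

EdgeType : Set
EdgeType = Multiset≤2 1 × Multiset≤2 0

c u : EdgeType → ℕ → ℕ
c (C , _) j = count C j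
u (_ , U) j = count U j

p q a b : EdgeType → ℕ
p t = c t 1
q t = c t 2
a t = u t 0
b t = u t 1

module _ {lo : ℕ} where

  infix 4 _≟_

  _≟_ : DecidableEquality (Multiset≤2 lo)
  multiset i j k _ ≟ multiset i′ j′ k′ _ =
    map′ (λ { (≡.refl , ≡.refl , ≡.refl) → ≡.refl })
         (λ { ≡.refl → ≡.refl , ≡.refl , ≡.refl })
         (i ℕ.≟ i′ ×-dec j ℕ.≟ j′ ×-dec k ℕ.≟ k′)

  ⟨_,_,_⟩ : ∀ i j k {_ : True (i ℕ.+ j ℕ.+ k ℕ.≤? 2)} → Multiset≤2 lo
  ⟨ i , j , k ⟩ {≤2} = multiset i j k (toWitness ≤2)

  multisets : List (Multiset≤2 lo)
  multisets = ⟨ 0 , 0 , 0 ⟩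
            ∷ ⟨ 1 , 0 , 0 ⟩ ∷ ⟨ 0 , 1 , 0 ⟩ ∷ ⟨ 0 , 0 , 1 ⟩
            ∷ ⟨ 2 , 0 , 0 ⟩ ∷ ⟨ 0 , 2 , 0 ⟩ ∷ ⟨ 0 , 0 , 2 ⟩
            ∷ ⟨ 1 , 1 , 0 ⟩ ∷ ⟨ 1 , 0 , 1 ⟩ ∷ ⟨ 0 , 1 , 1 ⟩
            ∷ []

  multisets-complete : ∀ M → M ∈ multisets
  multisets-complete (multiset i j k ≤2) = go i j k (recompute (_ ℕ.≤? 2) ≤2)
    where
    go : ∀ i j k (≤2 : i ℕ.+ j ℕ.+ k ℕ.≤ 2) → multiset i j k ≤2 ∈ multisets
    go 0 0 0 _ = here ≡.refl
    go 1 0 0 _ = there (here ≡.refl)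
    go 0 1 0 _ = there (there (here ≡.refl))
    go 0 0 1 _ = there (there (there (here ≡.refl)))
    go 2 0 0 _ = there (there (there (there (here ≡.refl))))
    go 0 2 0 _ = there (there (there (there (there (here ≡.refl)))))
    go 0 0 2 _ = there (there (there (there (there (there (here ≡.refl))))))
    go 1 1 0 _ = there (there (there (there (there (there (there (here ≡.refl)))))))
    go 1 0 1 _ = there (there (there (there (there (there (there (there (here ≡.refl))))))))
    go 0 1 1 _ = there (there (there (there (there (there (there (there (there (here ≡.refl)))))))))
    go 0 0 (suc (suc (suc _))) (s≤s (s≤s ()))
    go 0 1 (suc (suc _)) (s≤s (s≤s ()))
    go 0 2 (suc _) (s≤s (s≤s ()))
    go 0 (suc (suc (suc _))) _ (s≤s (s≤s ()))
    go 1 0 (suc (suc _)) (s≤s (s≤s ()))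
    go 1 1 (suc _) (s≤s (s≤s ()))
    go 1 (suc (suc _)) _ (s≤s (s≤s ()))
    go 2 0 (suc _) (s≤s (s≤s ()))
    go 2 (suc _) _ (s≤s (s≤s ()))
    go (suc (suc (suc _))) _ _ (s≤s (s≤s ()))

  multisets-unique : Unique multisets
  multisets-unique = from-yes (DecUnique.unique? _≟_ multisets)

edgeTypes : List EdgeType
edgeTypes = cartesianProduct multisets multisets

edgeTypes-complete : ∀ t → t ∈ edgeTypes
edgeTypes-complete (C , U) =
  ∈-cartesianProduct⁺ (multisets-complete C) (multisets-complete U)

edgeTypes-unique : Unique edgeTypes
edgeTypes-unique = cartesianProduct⁺ multisets-unique multisets-unique

------------------------------------------------------------------------
-- The cubic edge-type relaxation

module Relaxation {k ℓ₁ ℓ₂ ℓ₃} (F : OrderedField k ℓ₁ ℓ₂ ℓ₃) where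

  open OrderedField F public

  -- This is the sum over all types, as edgeTypes lists each of them
  -- exactly once.
  ∑ₜ : (EdgeType → Carrier) → Carrier
  ∑ₜ f = sum (map f (fromList edgeTypes))

  record IsDensity (x : EdgeType → Carrier) : Set (ℓ₁ ⊔ ℓ₃) where
    field
      nonNegative : ∀ t → 0# ≤ x t
      total       : ∑ₜ x ≈ 1#

  record Feasible (x : EdgeType → Carrier) : Set (ℓ₁ ⊔ ℓ₃) where
    field
      isDensity : IsDensity x
      perEdge   : ∀ t → 0# < x t →
                  3 ℕ.* p t ℕ.+ q t ℕ.≥ 3 ℕ.* a t ℕ.+ b t
      counting₁ : ∑ₜ (λ t → u t 1 · x t) ≈ 2 · ∑ₜ (λ t → c t 1 · x t)
      counting₂ : ∑ₜ (λ t → c t 2 · x t) ≈ 2 · ∑ₜ (λ t → u t 2 · x t)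

  ρ : (EdgeType → Carrier) → Carrier
  ρ x = ⅓ * ∑ₜ (λ t → u t 0 · x t)

  record LinearInequality : Set k where
    field
      coefficient : EdgeType → Carrier
      bound       : Carrier

  _SatisfiedBy_ : LinearInequality → (EdgeType → Carrier) → Set ℓ₃
  L SatisfiedBy x = bound ≤ ∑ₜ (λ t → coefficient t * x t)
    where open LinearInequality L

  module _ {ι} {I : Set ι} (L : I → LinearInequality) where

    Valid : Set (k ⊔ ℓ₁ ⊔ ℓ₃ ⊔ ι)
    Valid = ∀ i x → Feasible x → L i SatisfiedBy x

    -- The family may be combined with all constraints of the relaxation.
    -- Using fewer of them would make ForcesZero a stronger property, and
    -- hence its refutation weaker.
    ForcesZero : Set (k ⊔ ℓ₁ ⊔ ℓ₃ ⊔ ι)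
    ForcesZero = ∀ x → Feasible x → (∀ i → L i SatisfiedBy x) → ρ x ≈ 0#

module Submission where

open import Defs
open import Data.Product.Base using (∃-syntax; _×_; _,_)
open import Relation.Nullary.Negation using (¬_; contradiction)

import Algebra.Apartness.Properties.HeytingCommutativeRing as HeytingProperties
import Algebra.Properties.Monoid.Mult as MonoidMult
import Algebra.Properties.Monoid.Sum as MonoidSum
import Algebra.Properties.Ring as RingProperties
import Algebra.Properties.Semiring.Mult as SemiringMult
open import Algebra.Bundles using (CommutativeRing)
open import Data.List.Base as List using (List; []; _∷_)
open import Data.List.Relation.Unary.All as All using ()
import Data.Nat.Base as ℕ
open ℕ using (ℕ; zero; suc)
open import Data.Nat.ListAction using () renaming (sum to ∑)
import Data.Nat.Properties as ℕ
open import Data.Sum.Base using (_⊎_; inj₁; inj₂; fromInj₂)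
open import Data.Vec.Functional using (fromList; map)
open import Function.Bundles using (module Equivalence)
open import Relation.Binary.PropositionalEquality.Core as ≡ using (_≡_)
open import Relation.Nullary.Decidable using (from-yes; _⊎-dec_)
import Relation.Binary.Reasoning.Setoid as SetoidReasoning

-- Give weight 1/3 to each of the types ({1},{0}), ({2,2},{1,1}) and
-- (∅,{2}). The first two satisfy the per-edge inequality with equality,
-- the last one trivially; the totals of c₁, u₁, c₂, u₂ are 1, 2, 2, 1
-- thirds, and u₀ > 0 because of the first type. Since this point is
-- feasible, it satisfies every valid inequality.

weight : EdgeType → ℕ
weight (multiset 1 0 0 _ , multiset 1 0 0 _) = 1
weight (multiset 0 2 0 _ , multiset 0 2 0 _) = 1
weight (multiset 0 0 0 _ , multiset 0 0 1 _) = 1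
weight _                                     = 0

-- Both alternatives are decidable statements about `ℕ`, so evaluating the decision on the finite
-- list of all types settles the claim. The hypothesis `0# < x t` over an arbitrary ordered field
-- could not be decided this way.
weight-perEdge : ∀ t → weight t ≡ 0 ⊎ 3 ℕ.* p t ℕ.+ q t ℕ.≥ 3 ℕ.* a t ℕ.+ b t
weight-perEdge t = All.lookup (from-yes (All.all? dec edgeTypes)) (edgeTypes-complete t)
  where
  dec = λ t → (weight t ℕ.≟ 0) ⊎-dec (3 ℕ.* a t ℕ.+ b t ℕ.≤? 3 ℕ.* p t ℕ.+ q t)

weightedTotal : (EdgeType → ℕ) → ℕ
weightedTotal f = ∑ (List.map (λ t → f t ℕ.* weight t) edgeTypes)

module OrderedFieldProperties {k ℓ₁ ℓ₂ ℓ₃} (F : OrderedField k ℓ₁ ℓ₂ ℓ₃) where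

  open OrderedField F
  open CommutativeRing commutativeRing using (ring; semiring)
  open MonoidMult +-monoid using (×-homo-+; ×-assocˡ; ×-congʳ)
  open MonoidSum +-monoid using (sum-cong-≋)
  open SemiringMult semiring using (×-comm-*)
  open HeytingProperties heytingCommutativeRing using (x-0≈x; invertibleʳ⇒#)
  open RingProperties ring using (-‿distribˡ-*)
  open SetoidReasoning setoid

  sum-· : ∀ {A : Set} (f : A → ℕ) y (ts : List A) →
          sum (map (λ t → f t · y) (fromList ts)) ≈ ∑ (List.map f ts) · y
  sum-· f y []       = refl
  sum-· f y (t ∷ ts) = trans (+-congˡ (sum-· f y ts)) (sym (×-homo-+ y (f t) _))

  -- Separates the field element `y` from the numerical coefficients. For concrete `f`, `g` and `ts`
  -- the coefficient on the right is a closed natural number, computable independently of the field.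
  sum-·-· : ∀ {A : Set} (f g : A → ℕ) y (ts : List A) →
            sum (map (λ t → f t · g t · y) (fromList ts)) ≈
            ∑ (List.map (λ t → f t ℕ.* g t) ts) · y
  sum-·-· f g y ts =
    trans (sum-cong-≋ λ i → ×-assocˡ y (f (fromList ts i)) (g (fromList ts i)))
          (sum-· (λ t → f t ℕ.* g t) y ts)

  suc·-pos : ∀ {x} → 0# < x → ∀ n → 0# < suc n · x
  suc·-pos 0<x zero    = <-respʳ-≈ (sym (+-identityʳ _)) 0<x
  suc·-pos 0<x (suc n) =
    <-trans (suc·-pos 0<x n) (<-respˡ-≈ (+-identityˡ _) (+-monoˡ-< _ 0<x))

  ·-nonNeg : ∀ {x} → 0# < x → ∀ n → 0# ≤ n · x
  ·-nonNeg 0<x zero    = <-irrefl refl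
  ·-nonNeg 0<x (suc n) = <-asym (suc·-pos 0<x n)

  neg⇒-‿pos : ∀ {x} → x < 0# → 0# < - x
  neg⇒-‿pos {x} x<0 =
    <-respˡ-≈ (-‿inverseʳ x) (<-respʳ-≈ (+-identityˡ (- x)) (+-monoˡ-< (- x) x<0))

  -- Being invertible, `x` is apart from `0#`, hence positive or negative even though the order need
  -- not be decidable. If it were negative, `(- x) * y ≈ - 1#` would be positive, contradicting
  -- `0# < 1#`.
  x*y≈1⇒x-pos : ∀ {x y} → x * y ≈ 1# → 0# < y → 0# < x
  x*y≈1⇒x-pos {x} {y} xy≈1 0<y with Equivalence.to (#⇔<⊎> x 0#) x#0
    where
    x#0 : x # 0#
    x#0 = invertibleʳ⇒# (y , trans (*-congʳ (x-0≈x x)) xy≈1)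
  ... | inj₂ 0<x = 0<x
  ... | inj₁ x<0 = contradiction 1<0 (<-asym 0<1)
    where
    0<-1 : 0# < - 1#
    0<-1 = <-respʳ-≈ (trans (sym (-‿distribˡ-* x y)) (-‿cong xy≈1))
                     (*-pos (neg⇒-‿pos x<0) 0<y)
    1<0 : 1# < 0#
    1<0 = <-respˡ-≈ (+-identityˡ 1#) (<-respʳ-≈ (-‿inverseˡ 1#) (+-monoˡ-< 1# 0<-1))

  ⅓-pos : 0# < ⅓
  ⅓-pos = x*y≈1⇒x-pos ⅓-inverse (suc·1-pos 2)

  3·⅓≈1 : 3 · ⅓ ≈ 1#
  3·⅓≈1 = begin
    3 · ⅓          ≈⟨ ×-congʳ 3 (*-identityʳ ⅓) ⟨
    3 · (⅓ * 1#)   ≈⟨ ×-comm-* 3 ⅓ 1# ⟨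
    ⅓ * (3 · 1#)   ≈⟨ ⅓-inverse ⟩
    1#             ∎

module FeasiblePoint {k ℓ₁ ℓ₂ ℓ₃} (F : OrderedField k ℓ₁ ℓ₂ ℓ₃) where

  open Relaxation F
  open OrderedFieldProperties F
  open MonoidMult +-monoid using (×-assocˡ; ×-congʳ)

  x : EdgeType → Carrier
  x t = weight t · ⅓

  ∑-x : ∀ (f : EdgeType → ℕ) →
        ∑ₜ (λ t → f t · x t) ≈ weightedTotal f · ⅓
  ∑-x f = sum-·-· f weight ⅓ edgeTypes

  feasible : Feasible x
  feasible = record
    { isDensity = record
      { nonNegative = λ t → ·-nonNeg ⅓-pos (weight t)
      -- The weights add up to 3 by evaluation.
      ; total       = trans (sum-· weight ⅓ edgeTypes) 3·⅓≈1
      }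
    ; perEdge   = perEdge
    ; counting₁ = doubled (λ t → u t 1) (λ t → c t 1) ≡.refl
    ; counting₂ = doubled (λ t → c t 2) (λ t → u t 2) ≡.refl
    }
    where
    perEdge : ∀ t → 0# < x t → 3 ℕ.* p t ℕ.+ q t ℕ.≥ 3 ℕ.* a t ℕ.+ b t
    perEdge t 0<xt = fromInj₂
      -- If the weight is 0, then `x t` is `0 · ⅓`, which reduces to `0#` and so cannot be positive.
      (λ w≡0 → contradiction (≡.subst (λ n → 0# < n · ⅓) w≡0 0<xt) (<-irrefl refl))
      (weight-perEdge t)

    -- Reduces a counting constraint to an equation in `ℕ` by cancelling the common factor `⅓`. In
    -- both uses it reads 2 = 2 * 1 after evaluation, hence the proofs by `≡.refl`.
    doubled : ∀ f g → weightedTotal f ≡ 2 ℕ.* weightedTotal g →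
              ∑ₜ (λ t → f t · x t) ≈ 2 · ∑ₜ (λ t → g t · x t)
    doubled f g eq = trans (∑-x f) (trans (reflexive (≡.cong (_· ⅓) eq))
      (trans (sym (×-assocˡ ⅓ 2 (weightedTotal g))) (×-congʳ 2 (sym (∑-x g)))))

  ρ-pos : 0# < ρ x
  -- The weighted total of `u t 0` evaluates to 1, that is `suc 0`, which explains the argument 0;
  -- the density is `⅓ * (1 · ⅓)`, one ninth.
  ρ-pos = *-pos ⅓-pos (<-respʳ-≈ (sym (∑-x λ t → u t 0)) (suc·-pos ⅓-pos 0))

proposition4 : ∀ {k ℓ₁ ℓ₂ ℓ₃ ι} (F : OrderedField k ℓ₁ ℓ₂ ℓ₃) → let open Relaxation F in
    (∃[ x ] (Feasible x × 0# < ρ x)) ×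
    (∀ (I : Set ι) (L : I → LinearInequality) → Valid L → ¬ ForcesZero L)
proposition4 F = (x , feasible , ρ-pos) , λ I L valid forces →
    <-irrefl (sym (forces x feasible λ i → valid i x feasible)) ρ-pos
  where
  open Relaxation F
  open FeasiblePoint F
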